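{- The group $\mathcal{G}_{81}$ contains precisely $130$ subgroups isomorphic to $Z_3\times Z_3$. Under conjugation by $\mathcal{G}(\mathcal{L}_4)$ these fall into seven conjugacy classes $\mathcal{K}_1,\dots,\mathcal{K}_7$ of respective sizes $6,24,16,12,16,48,8$.
   Context: Work over $\mathbb{F}_2$. $V_8=V(8,2)=V_a\oplus V_b\oplus V_c\oplus V_d$ with each $V_h$ two-dimensional; $\mathcal{G}(\mathcal{L}_4)\le\operatorname{GL}(8,2)$ is the stabilizer of the set $\{V_a,V_b,V_c,V_d\}$, equal to $(\operatorname{GL}(V_a)\times\dots\times\operatorname{GL}(V_d))\rtimes\operatorname{Sym}(4)$. For $h\in\{a,b,c,d\}$ let $Z_h\cong Z_3$ be the subgroup of $\mathcal{G}(\mathcal{L}_4)$ fixing pointwise each $V_k$, $k\neq h$. $\mathcal{G}_{81}=Z_a\times Z_b\times Z_c\times Z_d\cong(Z_3)^4$, a normal subgroup of $\mathcal{G}(\mathcal{L}_4)$. -}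

module Defs where

open import Data.Bool using (Bool; true; false; _xor_; _∧_)
open import Data.Fin using (Fin; zero; suc; _≟_)
open import Data.Nat using (ℕ)
open import Data.Vec using (Vec; []; _∷_; lookup; tabulate; foldr; zipWith; replicate)
open import Data.List using (List; length; filter)
open import Data.List using (allFin)
open import Data.Product using (Σ; ∃; ∃-syntax; _×_; _,_)
open import Relation.Binary.PropositionalEquality using (_≡_)
open import Relation.Nullary using (¬_)
open import Level using (0ℓ)
open import Relation.Unary using (Pred)

F₂ : Set
F₂ = Bool

V₈ : Set
V₈ = Vec F₂ 8

Mat : Set
Mat = Vec (Vec F₂ 8) 8

dot : ∀ {n} → Vec F₂ n → Vec F₂ n → F₂
dot u v = foldr _ _xor_ false (zipWith _∧_ u v)

column : Mat → Fin 8 → Vec F₂ 8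
column A j = tabulate (λ i → lookup (lookup A i) j)

_·_ : Mat → Mat → Mat
A · B = tabulate (λ i → tabulate (λ j → dot (lookup A i) (column B j)))

_⊳_ : Mat → V₈ → V₈
A ⊳ v = tabulate (λ i → dot (lookup A i) v)

I₈ : Mat
I₈ = tabulate (λ i → tabulate (λ j → isEq i j))
  where
  isEq : Fin 8 → Fin 8 → Bool
  isEq i j with i ≟ j
  ... | Relation.Nullary.yes _ = true
  ... | Relation.Nullary.no _ = false

IsInvertible : Mat → Set
IsInvertible g = Σ Mat λ g' → (g · g' ≡ I₈) × (g' · g ≡ I₈)

-- The decomposition V₈ = V_a ⊕ V_b ⊕ V_c ⊕ V_d, indexed by Fin 4
-- (0 = a, 1 = b, 2 = c, 3 = d); V_h is spanned by the standard basis
-- vectors e_{2h}, e_{2h+1}.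

block : Fin 8 → Fin 4
block zero = zero
block (suc zero) = zero
block (suc (suc zero)) = suc zero
block (suc (suc (suc zero))) = suc zero
block (suc (suc (suc (suc zero)))) = suc (suc zero)
block (suc (suc (suc (suc (suc zero))))) = suc (suc zero)
block (suc (suc (suc (suc (suc (suc zero)))))) = suc (suc (suc zero))
block (suc (suc (suc (suc (suc (suc (suc zero))))))) = suc (suc (suc zero))

_∈V_ : V₈ → Fin 4 → Set
v ∈V h = ∀ i → ¬ (block i ≡ h) → lookup v i ≡ false

MapsOnto : Mat → Fin 4 → Fin 4 → Set
MapsOnto g h k =
  (∀ v → v ∈V h → (g ⊳ v) ∈V k) ×
  (∀ w → w ∈V k → Σ V₈ λ v → (v ∈V h) × (g ⊳ v ≡ w))

-- 𝒢(ℒ₄): elements of GL(8,2) stabilising the set {V_a, V_b, V_c, V_d}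
InGL4 : Mat → Set
InGL4 g = IsInvertible g × (∀ h → Σ (Fin 4) λ k → MapsOnto g h k)

-- the subgroup of 𝒢(ℒ₄) fixing pointwise every V_k with k ≠ h (≅ GL(V_h))
FixesOthers : Fin 4 → Mat → Set
FixesOthers h g = InGL4 g × (∀ k → ¬ (k ≡ h) → ∀ v → v ∈V k → g ⊳ v ≡ v)

-- Z_h ≅ Z₃: the elements of order dividing 3 in that subgroup
-- (its unique subgroup of order 3)
InZ : Fin 4 → Mat → Set
InZ h g = FixesOthers h g × (g · (g · g) ≡ I₈)

InG81 : Mat → Set
InG81 g = Σ Mat λ za → Σ Mat λ zb → Σ Mat λ zc → Σ Mat λ zd →
  InZ zero za × InZ (suc zero) zb × InZ (suc (suc zero)) zc ×
  InZ (suc (suc (suc zero))) zd × (g ≡ za · (zb · (zc · zd)))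

add3 : Fin 3 → Fin 3 → Fin 3
add3 zero y = y
add3 (suc zero) zero = suc zero
add3 (suc zero) (suc zero) = suc (suc zero)
add3 (suc zero) (suc (suc zero)) = zero
add3 (suc (suc zero)) zero = suc (suc zero)
add3 (suc (suc zero)) (suc zero) = zero
add3 (suc (suc zero)) (suc (suc zero)) = suc zero

Z3×Z3 : Set
Z3×Z3 = Fin 3 × Fin 3

_⊕_ : Z3×Z3 → Z3×Z3 → Z3×Z3
(a , b) ⊕ (c , d) = add3 a c , add3 b d

Subset : Set₁
Subset = Pred Mat 0ℓ

_≐_ : Subset → Subset → Set
H ≐ K = ∀ x → (H x → K x) × (K x → H x)

-- H is a subgroup of GL(8,2) isomorphic to Z₃ × Z₃: H is the image of an
-- injective group homomorphism Z₃ × Z₃ → GL(8,2)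
IsoZ3×Z3 : Subset → Set
IsoZ3×Z3 H = Σ (Z3×Z3 → Mat) λ φ →
  (∀ p q → φ (p ⊕ q) ≡ φ p · φ q) ×
  (∀ p q → φ p ≡ φ q → p ≡ q) ×
  (∀ x → (H x → ∃[ p ] φ p ≡ x) × (∃[ p ] φ p ≡ x → H x))

IsZ3²SubOfG81 : Subset → Set
IsZ3²SubOfG81 H = IsoZ3×Z3 H × (∀ x → H x → InG81 x)

-- H and K are conjugate by an element of 𝒢(ℒ₄): g H g⁻¹ = K
ConjugateInGL4 : Subset → Subset → Set
ConjugateInGL4 H K = Σ Mat λ g → InGL4 g ×
  (∀ x → H x → Σ Mat λ y → K y × (g · x ≡ y · g)) ×
  (∀ y → K y → Σ Mat λ x → H x × (g · x ≡ y · g))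

fiberSize : ∀ {n m} → (Fin n → Fin m) → Fin m → ℕ
fiberSize {n} f c = length (filter (λ i → f i ≟ c) (allFin n))

{-# OPTIONS --safe #-}
-- The group 𝒢₈₁ is identified with F₃⁴ via u ↦ diag(ω^{u_a}, ω^{u_b}, ω^{u_c}, ω^{u_d}), so its
-- subgroups Z₃ × Z₃ are the two-dimensional subspaces of F₃⁴, listed by their reduced row echelon
-- forms. An element of 𝒢(ℒ₄) permutes the blocks, and a coordinate of u vanishes exactly when the
-- corresponding block is fixed pointwise; hence conjugation preserves Hamming weights, and the set of
-- weights occurring in a subspace separates the seven classes. Conversely, transpositions and
-- sign changes of the coordinates are realised in 𝒢(ℒ₄), and each echelon form that is not a chosen
-- representative is carried by one of them to an earlier one.
module Submission where

open import Defs
open import Data.Fin using (Fin; zero; suc)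
open import Data.Nat using (ℕ)
open import Data.Vec using (Vec; []; _∷_; lookup)
open import Data.Product using (Σ; _×_; _,_)
open import Relation.Binary.PropositionalEquality using (_≡_)
open import Function.Bundles using (_⇔_)

open import Algebra.Bundles using (CommutativeRing; Monoid)
import Algebra.Properties.CommutativeMonoid.Sum as CommutativeMonoidSum
import Algebra.Properties.Monoid as MonoidProperties
import Algebra.Properties.Semiring.Sum as SemiringSum
open import Data.Bool using (Bool; true; false; not; _xor_; _∧_; if_then_else_)
open import Data.Bool.Properties
  using (xor-∧-commutativeRing; ∧-comm; ∧-assoc; ∧-zeroʳ; xor-identityʳ)
  renaming (_≟_ to _≟ᵇ_)
open import Data.Fin using (#_; _≟_; combine; opposite; remainder; toℕ)
open import Data.Fin.Permutation.Components using (transpose)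
open import Data.Fin.Properties using (all?; any?)
open import Data.Fin.Subset using (∣_∣) renaming (Subset to Subset₀)
import Data.List as List
open import Data.List
  using (List; []; _∷_; _++_; allFin; cartesianProductWith; concatMap; filter; head)
open import Data.List.Membership.Propositional using (_∈_; lose)
open import Data.List.Membership.Propositional.Properties
  using (∈-allFin; ∈-cartesianProductWith⁺; ∈-concatMap⁺; ∈-map⁺)
open import Data.List.Relation.Unary.Any using (Any; here; index; satisfied)
  renaming (any? to any-List?)
open import Data.List.Relation.Unary.Any.Properties using (lookup-index)
open import Data.Maybe using (Maybe; just; nothing) renaming (map to map-Maybe)
open import Data.Maybe.Properties using () renaming (≡-dec to ≡-dec-Maybe)
import Data.Maybe.Relation.Unary.All as MaybeAll
import Data.Maybe.Relation.Unary.Any as MaybeAny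
open import Data.Nat using (_+_; _*_; _<_; _<?_) renaming (_≟_ to _≟ⁿ_)
open import Data.Nat.Induction using (<-wellFounded)
open import Data.Product using (∃; ∃-syntax; proj₁; proj₂)
open import Data.Product.Properties using () renaming (≡-dec to ≡-dec-Σ)
open import Data.Sum using (_⊎_; inj₁; inj₂)
open import Data.Vec using (tabulate; zipWith; replicate; map; foldl; foldr; _[_]≔_)
open import Data.Vec.Properties
  using ( lookup∘tabulate; tabulate∘lookup; tabulate-cong; zipWith-comm
        ; lookup-map; lookup-zipWith; lookup-replicate; lookup∘update′ )
  renaming (≡-dec to ≡-dec-Vec)
open import Function using (id; case_of_)
open import Function.Bundles using (mk⇔)
open import Induction.WellFounded using (Acc; acc)
open import Level using (0ℓ)
open import Relation.Binary.PropositionalEquality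
  using (_≢_; isEquivalence; refl; sym; trans; cong; cong₂; subst; module ≡-Reasoning)
open import Relation.Nullary using (Dec; yes; no; does; contradiction)
open import Relation.Nullary.Decidable
  using ( map′; ¬?; _×-dec_; _⊎-dec_; _→-dec_; does-⇔; dec-true; dec-false
        ; True; toWitness )
open import Relation.Unary using (Decidable)

-- The obstacle is size: 8 × 8 matrices over `F₂` cannot be enumerated, so whatever concerns an
-- arbitrary element of 𝒢(ℒ₄) is argued algebraically, through entries and fixed vectors, and
-- evaluation is confined to small types: exponents, vectors of F₃⁴, echelon forms, 2 × 2 blocks.
-- Signed permutations are enough to merge the classes. The abelian group 𝒢₈₁ acts trivially on
-- itself by conjugation, and each factor GL(V_h) ≅ Sym(3) acts on Z_h only through inversion, so
-- 𝒢(ℒ₄) acts on F₃⁴ as the group 2⁴ : Sym(4) of order 384. The class of a plane is defined by its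
-- set of weights. Invariance of weights makes the class constant along each step towards an earlier
-- form, so a descent can only stop at the representative of the class it started in. The sizes of
-- the classes are then a count over the list of echelon forms.

-- Deciding statements over finite types by evaluation.

decide : ∀ {A : Set} (a? : Dec A) {_ : True a?} → A
decide a? {yes!} = toWitness yes!

Exhaustible : Set → Set₁
Exhaustible A = ∀ {P : A → Set} → Decidable P → Dec (∀ x → P x)

all-Bool? : Exhaustible Bool
all-Bool? P? = map′ (λ { (f , t) false → f ; (f , t) true → t })
                    (λ f → f false , f true)
                    (P? false ×-dec P? true)

all-Vec? : ∀ {A} → Exhaustible A → ∀ n → Exhaustible (Vec A n)
all-Vec? all-A? ℕ.zero P? = map′ (λ { p [] → p }) (λ f → f []) (P? [])
all-Vec? all-A? (ℕ.suc n) P? =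
  map′ (λ { f (x ∷ xs) → f x xs }) (λ f x xs → f (x ∷ xs))
       (all-A? λ x → all-Vec? all-A? n λ xs → P? (x ∷ xs))

all-Σ? : ∀ {A : Set} {B : A → Set} → Exhaustible A → (∀ x → Exhaustible (B x)) →
         Exhaustible (Σ A B)
all-Σ? all-A? all-B? P? =
  map′ (λ { f (x , y) → f x y }) (λ f x y → f (x , y))
       (all-A? λ x → all-B? x λ y → P? (x , y))

-- Matrix algebra over `F₂`.

open CommutativeRing xor-∧-commutativeRing using (semiring; +-commutativeMonoid)
open CommutativeMonoidSum +-commutativeMonoid
  using (sum; sum-cong-≗; sum-replicate-zero; ∑-comm)
open SemiringSum semiring using (*-distribˡ-sum; *-distribʳ-sum)

_⟨_,_⟩ : Mat → Fin 8 → Fin 8 → F₂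
A ⟨ i , j ⟩ = lookup (lookup A i) j

Vec-ext : ∀ {A : Set} {n} {u v : Vec A n} → (∀ i → lookup u i ≡ lookup v i) → u ≡ v
Vec-ext {u = u} {v} eq =
  trans (sym (tabulate∘lookup u)) (trans (tabulate-cong eq) (tabulate∘lookup v))

Mat-ext : ∀ {A B} → (∀ i j → A ⟨ i , j ⟩ ≡ B ⟨ i , j ⟩) → A ≡ B
Mat-ext eq = Vec-ext (λ i → Vec-ext (eq i))

matrix : (Fin 8 → Fin 8 → F₂) → Mat
matrix f = tabulate (λ i → tabulate (f i))

matrix-entry : ∀ f i j → matrix f ⟨ i , j ⟩ ≡ f i j
matrix-entry f i j = trans (cong (λ r → lookup r j) (lookup∘tabulate (λ i → tabulate (f i)) i))
                           (lookup∘tabulate (f i) j)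

dot-sum : ∀ {n} (u v : Vec F₂ n) → dot u v ≡ sum (λ i → lookup u i ∧ lookup v i)
dot-sum [] [] = refl
dot-sum (x ∷ u) (y ∷ v) = cong ((x ∧ y) xor_) (dot-sum u v)

dot-comm : ∀ {n} (u v : Vec F₂ n) → dot u v ≡ dot v u
dot-comm u v = cong (foldr _ _xor_ false) (zipWith-comm ∧-comm u v)

⊳-entry : ∀ A v i → lookup (A ⊳ v) i ≡ dot (lookup A i) v
⊳-entry A v i = lookup∘tabulate (λ i → dot (lookup A i) v) i

⊳-sum : ∀ A v i → lookup (A ⊳ v) i ≡ sum (λ j → A ⟨ i , j ⟩ ∧ lookup v j)
⊳-sum A v i = trans (⊳-entry A v i) (dot-sum (lookup A i) v)

column-entry : ∀ A i j → lookup (column A j) i ≡ A ⟨ i , j ⟩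
column-entry A i j = lookup∘tabulate (λ i → A ⟨ i , j ⟩) i

-- Opaque, because unification would otherwise unfold 8 × 8 products entry by entry.
opaque
  _⊗_ : Mat → Mat → Mat
  _⊗_ = _·_

  ⊗-def : ∀ A B → A ⊗ B ≡ A · B
  ⊗-def A B = refl

⊗-entry : ∀ A B i j → (A ⊗ B) ⟨ i , j ⟩ ≡ dot (lookup A i) (column B j)
⊗-entry A B i j = trans (cong _⟨ i , j ⟩ (⊗-def A B))
  (matrix-entry (λ i j → dot (lookup A i) (column B j)) i j)

column-⊗ : ∀ A B j → column (A ⊗ B) j ≡ A ⊳ column B j
column-⊗ A B j = tabulate-cong (λ i → ⊗-entry A B i j)

column-ext : ∀ {A B} → (∀ j → column A j ≡ column B j) → A ≡ B
column-ext {A} {B} eq = Mat-ext λ i j →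
  trans (sym (column-entry A i j))
        (trans (cong (λ c → lookup c i) (eq j)) (column-entry B i j))

⊳-⊗ : ∀ A B v → (A ⊗ B) ⊳ v ≡ A ⊳ (B ⊳ v)
⊳-⊗ A B v = Vec-ext λ i → begin
  lookup ((A ⊗ B) ⊳ v) i
    ≡⟨ ⊳-sum (A ⊗ B) v i ⟩
  sum (λ j → (A ⊗ B) ⟨ i , j ⟩ ∧ lookup v j)
    ≡⟨ sum-cong-≗ (λ j → trans (cong (_∧ lookup v j) (entry i j))
         (trans (*-distribʳ-sum (lookup v j) (λ k → A ⟨ i , k ⟩ ∧ B ⟨ k , j ⟩))
                (sum-cong-≗ (λ k → ∧-assoc (A ⟨ i , k ⟩) (B ⟨ k , j ⟩) (lookup v j))))) ⟩
  sum (λ j → sum (λ k → A ⟨ i , k ⟩ ∧ (B ⟨ k , j ⟩ ∧ lookup v j)))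
    ≡⟨ ∑-comm (λ j k → A ⟨ i , k ⟩ ∧ (B ⟨ k , j ⟩ ∧ lookup v j)) ⟩
  sum (λ k → sum (λ j → A ⟨ i , k ⟩ ∧ (B ⟨ k , j ⟩ ∧ lookup v j)))
    ≡⟨ sum-cong-≗ (λ k → trans (cong (A ⟨ i , k ⟩ ∧_) (⊳-sum B v k))
         (*-distribˡ-sum (A ⟨ i , k ⟩) (λ j → B ⟨ k , j ⟩ ∧ lookup v j))) ⟨
  sum (λ k → A ⟨ i , k ⟩ ∧ lookup (B ⊳ v) k)
    ≡⟨ ⊳-sum A (B ⊳ v) i ⟨
  lookup (A ⊳ (B ⊳ v)) i ∎
  where
  open ≡-Reasoning
  entry : ∀ i j → (A ⊗ B) ⟨ i , j ⟩ ≡ sum (λ k → A ⟨ i , k ⟩ ∧ B ⟨ k , j ⟩)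
  entry i j = trans (⊗-entry A B i j) (trans (dot-sum (lookup A i) (column B j))
    (sum-cong-≗ (λ k → cong (A ⟨ i , k ⟩ ∧_) (column-entry B k j))))

-- Column j of a product is the left factor applied to column j of the right one, so associativity
-- reduces to the action law `⊳-⊗`, where the exchange of the two sums takes place.
⊗-assoc : ∀ A B C → (A ⊗ B) ⊗ C ≡ A ⊗ (B ⊗ C)
⊗-assoc A B C = column-ext λ j → begin
  column ((A ⊗ B) ⊗ C) j   ≡⟨ column-⊗ (A ⊗ B) C j ⟩
  (A ⊗ B) ⊳ column C j     ≡⟨ ⊳-⊗ A B (column C j) ⟩
  A ⊳ (B ⊳ column C j)     ≡⟨ cong (A ⊳_) (column-⊗ B C j) ⟨
  A ⊳ column (B ⊗ C) j     ≡⟨ column-⊗ A (B ⊗ C) j ⟨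
  column (A ⊗ (B ⊗ C)) j   ∎
  where open ≡-Reasoning

I⊳ : ∀ v → I₈ ⊳ v ≡ v
I⊳ (a ∷ b ∷ c ∷ d ∷ e ∷ f ∷ g ∷ h ∷ [])
  -- The rows of `I₈` compute, and each entry of `I₈ ⊳ v` normalises to a coordinate of `v` xor
  -- `false`.
  rewrite xor-identityʳ a | xor-identityʳ b | xor-identityʳ c | xor-identityʳ d
        | xor-identityʳ e | xor-identityʳ f | xor-identityʳ g | xor-identityʳ h = refl

⊗-identityˡ : ∀ A → I₈ ⊗ A ≡ A
⊗-identityˡ A = column-ext λ j → trans (column-⊗ I₈ A j) (I⊳ (column A j))

column-I : ∀ j → column I₈ j ≡ lookup I₈ j
column-I = decide (all? λ j → ≡-dec-Vec _≟ᵇ_ (column I₈ j) (lookup I₈ j))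

dot-I : ∀ v j → dot (lookup I₈ j) v ≡ lookup v j
dot-I v j = trans (sym (⊳-entry I₈ v j)) (cong (λ r → lookup r j) (I⊳ v))

dot-column-I : ∀ v j → dot v (column I₈ j) ≡ lookup v j
dot-column-I v j =
  trans (dot-comm v (column I₈ j)) (trans (cong (λ r → dot r v) (column-I j)) (dot-I v j))

⊗-identityʳ : ∀ A → A ⊗ I₈ ≡ A
⊗-identityʳ A = Mat-ext λ i j → trans (⊗-entry A I₈ i j) (dot-column-I (lookup A i) j)

basis : Fin 8 → V₈
basis j = column I₈ j

⊳-basis : ∀ A j → A ⊳ basis j ≡ column A j
⊳-basis A j = trans (sym (column-⊗ A I₈ j)) (cong (λ B → column B j) (⊗-identityʳ A))

⊳-basis-entry : ∀ A i j → lookup (A ⊳ basis j) i ≡ A ⟨ i , j ⟩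
⊳-basis-entry A i j = trans (cong (λ c → lookup c i) (⊳-basis A j)) (column-entry A i j)

I-diagonal : ∀ j → I₈ ⟨ j , j ⟩ ≡ true
I-diagonal = decide (all? λ j → I₈ ⟨ j , j ⟩ ≟ᵇ true)

basis-self : ∀ j → lookup (basis j) j ≡ true
basis-self j = trans (column-entry I₈ j j) (I-diagonal j)

basis-∈V : ∀ j → basis j ∈V block j
basis-∈V = decide (all? λ j → all? λ i →
  ¬? (block i ≟ block j) →-dec (lookup (basis j) i ≟ᵇ false))

-- Packaged as a bundle so that inverses of products and composed conjugations follow from generic
-- cancellation laws of monoids.
⊗-monoid : Monoid 0ℓ 0ℓ
⊗-monoid = record
  { isMonoid = record
    { isSemigroup = record
      { isMagma = record { isEquivalence = isEquivalence ; ∙-cong = cong₂ _⊗_ }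
      ; assoc = ⊗-assoc
      }
    ; identity = ⊗-identityˡ , ⊗-identityʳ
    }
  }

module _ {c ℓ} (M : Monoid c ℓ) where
  open Monoid M renaming (trans to ≈-trans)
  open MonoidProperties M

  ∙-inverse : ∀ {g g' h h'} → g ∙ g' ≈ ε → h ∙ h' ≈ ε → (g ∙ h) ∙ (h' ∙ g') ≈ ε
  ∙-inverse {g} {g'} gg' hh' = ≈-trans (cancelᶜ hh' g g') gg'

  ∙-intertwine : ∀ {g h x y z} → g ∙ x ≈ y ∙ g → h ∙ y ≈ z ∙ h → (h ∙ g) ∙ x ≈ z ∙ (h ∙ g)
  ∙-intertwine {g} {h} gx hy = ≈-trans (uv≈w⇒xu∙v≈xw gx h) (uv≈wx⇒u∙vy≈w∙xy hy g)

opaque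
  unfolding _⊗_

  ⊗⇒·≡I : ∀ {A B} → A ⊗ B ≡ I₈ → A · B ≡ I₈
  ⊗⇒·≡I eq = eq

  ·⇒⊗≡I : ∀ A B → A · B ≡ I₈ → A ⊗ B ≡ I₈
  ·⇒⊗≡I A B eq = eq

  ·-commuting : ∀ g x y → g ⊗ x ≡ y ⊗ g → g · x ≡ y · g
  ·-commuting g x y eq = eq

  ⊗-triple : ∀ A B C → A ⊗ (B ⊗ C) ≡ A · (B · C)
  ⊗-triple A B C = refl

  ⊗-quadruple : ∀ A B C D → A ⊗ (B ⊗ (C ⊗ D)) ≡ A · (B · (C · D))
  ⊗-quadruple A B C D = refl

  ⊗-commuting : ∀ g x y → g · x ≡ y · g → g ⊗ x ≡ y ⊗ g
  ⊗-commuting g x y eq = eq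

-- The stabiliser of the four blocks.

⊳-injective : ∀ {g} → IsInvertible g → ∀ {v w} → g ⊳ v ≡ g ⊳ w → v ≡ w
⊳-injective {g} (g' , _ , inv) {v} {w} eq =
  trans (sym (cancel v)) (trans (cong (g' ⊳_) eq) (cancel w))
  where
  cancel : ∀ v → g' ⊳ (g ⊳ v) ≡ v
  cancel v = trans (sym (⊳-⊗ g' g v)) (trans (cong (_⊳ v) (·⇒⊗≡I g' g inv)) (I⊳ v))

∈V-disjoint : ∀ {v h k} j → lookup v j ≡ true → v ∈V h → v ∈V k → h ≡ k
∈V-disjoint {v} {h} {k} j vj∈ v∈h v∈k = trans (sym (block≡ h v∈h)) (block≡ k v∈k)
  where
  block≡ : ∀ h → v ∈V h → block j ≡ h
  block≡ h v∈h with block j ≟ h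
  ... | yes eq = eq
  ... | no ≢h = case trans (sym vj∈) (v∈h j ≢h) of λ ()

-- The entrywise form of A(V_h) ⊆ V_k, which turns a condition on vectors into a check of 64
-- entries.
BlockEntries : Mat → Fin 4 → Fin 4 → Set
BlockEntries A h k = ∀ i j → block j ≡ h → block i ≢ k → A ⟨ i , j ⟩ ≡ false

blockEntries? : ∀ A h k → Dec (BlockEntries A h k)
blockEntries? A h k = all? λ i → all? λ j →
  (block j ≟ h) →-dec (¬? (block i ≟ k) →-dec (A ⟨ i , j ⟩ ≟ᵇ false))

maps-into : ∀ A {h k} → BlockEntries A h k → ∀ v → v ∈V h → (A ⊳ v) ∈V k
maps-into A {h} entries v v∈h i i∉k =
  trans (⊳-sum A v i) (trans (sum-cong-≗ term) (sum-replicate-zero 8))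
  where
  term : ∀ j → A ⟨ i , j ⟩ ∧ lookup v j ≡ false
  term j with block j ≟ h
  ... | yes j∈h = cong (_∧ lookup v j) (entries i j j∈h i∉k)
  ... | no j∉h = trans (cong (A ⟨ i , j ⟩ ∧_) (v∈h j j∉h)) (∧-zeroʳ _)

-- A right inverse that carries V_k back into V_h supplies the preimage `B ⊳ w` of each `w` in V_k.
maps-onto : ∀ A B {h k} → A ⊗ B ≡ I₈ → BlockEntries A h k → BlockEntries B k h → MapsOnto A h k
maps-onto A B inv into back = maps-into A into , λ w w∈k →
  B ⊳ w , maps-into B back w w∈k , trans (sym (⊳-⊗ A B w)) (trans (cong (_⊳ w) inv) (I⊳ w))

fixes-block : ∀ A {k} → (∀ i j → block j ≡ k → A ⟨ i , j ⟩ ≡ I₈ ⟨ i , j ⟩) →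
              ∀ v → v ∈V k → A ⊳ v ≡ v
fixes-block A {k} entries v v∈k = trans (Vec-ext λ i →
  trans (⊳-sum A v i) (trans (sum-cong-≗ (term i)) (sym (⊳-sum I₈ v i)))) (I⊳ v)
  where
  term : ∀ i j → A ⟨ i , j ⟩ ∧ lookup v j ≡ I₈ ⟨ i , j ⟩ ∧ lookup v j
  term i j with block j ≟ k
  ... | yes j∈k = cong (_∧ lookup v j) (entries i j j∈k)
  ... | no j∉k rewrite v∈k j j∉k = trans (∧-zeroʳ _) (sym (∧-zeroʳ _))

InGL4-· : ∀ {g h} → InGL4 g → InGL4 h → InGL4 (g ⊗ h)
InGL4-· {g} {h} ((g' , gg' , g'g) , mg) ((h' , hh' , h'h) , mh) =
  (h' ⊗ g' , ⊗⇒·≡I (∙-inverse ⊗-monoid (·⇒⊗≡I g g' gg') (·⇒⊗≡I h h' hh'))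
           , ⊗⇒·≡I (∙-inverse ⊗-monoid (·⇒⊗≡I h' h h'h) (·⇒⊗≡I g' g g'g))) ,
  λ a → let (b , into₁ , onto₁) = mh a ; (c , into₂ , onto₂) = mg b in
    c ,
    (λ v v∈a → subst (_∈V c) (sym (⊳-⊗ g h v)) (into₂ _ (into₁ v v∈a))) ,
    (λ w w∈c → let (y , y∈b , gy≡w) = onto₂ w w∈c
                   (x , x∈a , hx≡y) = onto₁ y y∈b
               in x , x∈a , trans (⊳-⊗ g h x) (trans (cong (g ⊳_) hx≡y) gy≡w))

ConjugateInGL4-trans : ∀ {H K L} →
                       ConjugateInGL4 H K → ConjugateInGL4 K L → ConjugateInGL4 H L
ConjugateInGL4-trans (g , g∈ , to , from) (h , h∈ , to' , from') =
  h ⊗ g , InGL4-· h∈ g∈ ,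
  (λ x x∈ → let (y , y∈ , gx) = to x x∈ ; (z , z∈ , hy) = to' y y∈ in
     z , z∈ , intertwine x y z gx hy) ,
  (λ z z∈ → let (y , y∈ , hy) = from' z z∈ ; (x , x∈ , gx) = from y y∈ in
     x , x∈ , intertwine x y z gx hy)

  where
  intertwine : ∀ x y z → g · x ≡ y · g → h · y ≡ z · h → (h ⊗ g) · x ≡ z · (h ⊗ g)
  intertwine x y z gx hy = ·-commuting (h ⊗ g) x z
    (∙-intertwine ⊗-monoid {g} {h} {x} {y} {z} (⊗-commuting g x y gx) (⊗-commuting h y z hy))

-- Permutation matrices of involutions.

permutationMat : (Fin 8 → Fin 8) → Mat
permutationMat σ = matrix (λ i j → I₈ ⟨ σ i , j ⟩)

permutationMat-⊗ˡ : ∀ σ A i j → (permutationMat σ ⊗ A) ⟨ i , j ⟩ ≡ A ⟨ σ i , j ⟩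
permutationMat-⊗ˡ σ A i j = begin
  (permutationMat σ ⊗ A) ⟨ i , j ⟩                   ≡⟨ ⊗-entry (permutationMat σ) A i j ⟩
  dot (lookup (permutationMat σ) i) (column A j)     ≡⟨ cong (λ r → dot r (column A j)) row ⟩
  dot (lookup I₈ (σ i)) (column A j)                 ≡⟨ ⊳-entry I₈ (column A j) (σ i) ⟨
  lookup (I₈ ⊳ column A j) (σ i)                     ≡⟨ cong (λ c → lookup c (σ i)) (I⊳ (column A j)) ⟩
  lookup (column A j) (σ i)                          ≡⟨ column-entry A (σ i) j ⟩
  A ⟨ σ i , j ⟩                                      ∎
  where
  open ≡-Reasoning
  row : lookup (permutationMat σ) i ≡ lookup I₈ (σ i)
  row = Vec-ext (matrix-entry (λ i j → I₈ ⟨ σ i , j ⟩) i)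

I-off-diagonal : ∀ i j → i ≢ j → I₈ ⟨ i , j ⟩ ≡ false
I-off-diagonal = decide (all? λ i → all? λ j → ¬? (i ≟ j) →-dec (I₈ ⟨ i , j ⟩ ≟ᵇ false))

-- For an involution, σ i = j exactly when i = σ j. The permutation matrix is therefore symmetric
-- and permutes columns by the same σ by which it permutes rows.
I-involution : (σ : Fin 8 → Fin 8) → (∀ i → σ (σ i) ≡ i) → ∀ i j → I₈ ⟨ σ i , j ⟩ ≡ I₈ ⟨ i , σ j ⟩
I-involution σ inv i j = by-cases (σ i ≟ j)
  where
  by-cases : Dec (σ i ≡ j) → I₈ ⟨ σ i , j ⟩ ≡ I₈ ⟨ i , σ j ⟩
  by-cases (yes refl) =
    trans (I-diagonal (σ i)) (sym (trans (cong (I₈ ⟨ i ,_⟩) (inv i)) (I-diagonal i)))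
  by-cases (no σi≢j) =
    trans (I-off-diagonal (σ i) j σi≢j)
          (sym (I-off-diagonal i (σ j) λ i≡ → σi≢j (trans (cong σ i≡) (inv j))))

permutationMat-⊗ʳ : (σ : Fin 8 → Fin 8) → (∀ i → σ (σ i) ≡ i) →
                    ∀ A i j → (A ⊗ permutationMat σ) ⟨ i , j ⟩ ≡ A ⟨ i , σ j ⟩
permutationMat-⊗ʳ σ inv A i j = begin
  (A ⊗ permutationMat σ) ⟨ i , j ⟩               ≡⟨ ⊗-entry A (permutationMat σ) i j ⟩
  dot (lookup A i) (column (permutationMat σ) j) ≡⟨ cong (dot (lookup A i)) col ⟩
  dot (lookup A i) (column I₈ (σ j))             ≡⟨ ⊗-entry A I₈ i (σ j) ⟨
  (A ⊗ I₈) ⟨ i , σ j ⟩                           ≡⟨ cong (_⟨ i , σ j ⟩) (⊗-identityʳ A) ⟩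
  A ⟨ i , σ j ⟩                                  ∎
  where
  open ≡-Reasoning
  col : column (permutationMat σ) j ≡ column I₈ (σ j)
  col = tabulate-cong λ k → trans (matrix-entry (λ i j → I₈ ⟨ σ i , j ⟩) k j) (I-involution σ inv k j)

-- Exponent vectors in F₃⁴ and the block diagonal matrices they define.

Code : Set
Code = Vec (Fin 3) 4

all-Code? : Exhaustible Code
all-Code? = all-Vec? all? 4

mul3 : Fin 3 → Fin 3 → Fin 3
mul3 zero y = zero
mul3 (suc zero) y = y
mul3 (suc (suc zero)) y = add3 y y

neg3 : Fin 3 → Fin 3
neg3 = mul3 (suc (suc zero))

_⊞_ : ∀ {n} → Vec (Fin 3) n → Vec (Fin 3) n → Vec (Fin 3) n
_⊞_ = zipWith add3

0̂ : Code
0̂ = replicate 4 zero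

single : Fin 4 → Fin 3 → Code
single h t = 0̂ [ h ]≔ t

-- The powers of a companion matrix of x² + x + 1, the minimal polynomial of an element of order 3
-- in GL(2,2).
ω^ : Fin 3 → Vec (Vec F₂ 2) 2
ω^ zero = (true ∷ false ∷ []) ∷ (false ∷ true ∷ []) ∷ []
ω^ (suc zero) = (false ∷ true ∷ []) ∷ (true ∷ true ∷ []) ∷ []
ω^ (suc (suc zero)) = (true ∷ true ∷ []) ∷ (true ∷ false ∷ []) ∷ []

parity : Fin 8 → Fin 2
parity = remainder {4} 2

at : Fin 4 → Fin 2 → Fin 8
at = combine

-- An entry depends on one exponent only. Taking that exponent, rather than a whole vector of F₃⁴,
-- as the argument keeps the checks below to a few hundred cases.
ω-entry : Fin 8 → Fin 8 → Fin 3 → F₂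
ω-entry i j t =
  if does (block i ≟ block j) then lookup (lookup (ω^ t) (parity i)) (parity j) else false

ω-entry-off : ∀ i j t → block i ≢ block j → ω-entry i j t ≡ false
ω-entry-off = decide (all? λ i → all? λ j → all? λ t →
  ¬? (block i ≟ block j) →-dec (ω-entry i j t ≟ᵇ false))

-- Outside the diagonal blocks the entry is `false` whatever the exponent, so exponents need to
-- agree only when `i` and `j` lie in one block.
ω-entry-cong : ∀ i j s t → (block i ≡ block j → s ≡ t) → ω-entry i j s ≡ ω-entry i j t
ω-entry-cong = decide (all? λ i → all? λ j → all? λ s → all? λ t →
  ((block i ≟ block j) →-dec (s ≟ t)) →-dec (ω-entry i j s ≟ᵇ ω-entry i j t))

ω-entry-zero : ∀ i j → ω-entry i j zero ≡ I₈ ⟨ i , j ⟩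
ω-entry-zero = decide (all? λ i → all? λ j → ω-entry i j zero ≟ᵇ (I₈ ⟨ i , j ⟩))

ω-entry-faithful : ∀ h s t → (∀ a b → ω-entry (at h a) (at h b) s ≡ ω-entry (at h a) (at h b) t) → s ≡ t
ω-entry-faithful = decide (all? λ h → all? λ s → all? λ t →
  (all? λ a → all? λ b → ω-entry (at h a) (at h b) s ≟ᵇ ω-entry (at h a) (at h b) t) →-dec (s ≟ t))

ω-entry-product : ∀ i j s t →
  dot (tabulate (λ k → ω-entry i k s)) (tabulate (λ k → ω-entry k j t)) ≡ ω-entry i j (add3 s t)
ω-entry-product = decide (all? λ i → all? λ j → all? λ s → all? λ t →
  dot (tabulate (λ k → ω-entry i k s)) (tabulate (λ k → ω-entry k j t)) ≟ᵇ ω-entry i j (add3 s t))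

block-at : ∀ h a → block (at h a) ≡ h
block-at = decide (all? λ h → all? λ a → block (at h a) ≟ h)

at-parity : ∀ i → at (block i) (parity i) ≡ i
at-parity = decide (all? λ i → at (block i) (parity i) ≟ i)

opaque
  ω-diag : Code → Mat
  ω-diag u = matrix (λ i j → ω-entry i j (lookup u (block i)))

  ω-diag-entry : ∀ u i j → ω-diag u ⟨ i , j ⟩ ≡ ω-entry i j (lookup u (block i))
  ω-diag-entry u = matrix-entry (λ i j → ω-entry i j (lookup u (block i)))

ω-diag-⊞ : ∀ u v → ω-diag (u ⊞ v) ≡ ω-diag u ⊗ ω-diag v
ω-diag-⊞ u v = Mat-ext λ i j → begin
  ω-diag (u ⊞ v) ⟨ i , j ⟩
    ≡⟨ ω-diag-entry (u ⊞ v) i j ⟩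
  ω-entry i j (lookup (u ⊞ v) (block i))
    ≡⟨ cong (ω-entry i j) (lookup-zipWith add3 (block i) u v) ⟩
  ω-entry i j (add3 (lookup u (block i)) (lookup v (block i)))
    -- The exponent taken from `v` moves from the block of the row to the block of the column.
    -- Either the two blocks coincide or both entries vanish.
    ≡⟨ ω-entry-cong i j (add3 (lookup u (block i)) (lookup v (block i)))
                         (add3 (lookup u (block i)) (lookup v (block j)))
         (cong (λ h → add3 (lookup u (block i)) (lookup v h))) ⟩
  ω-entry i j (add3 (lookup u (block i)) (lookup v (block j)))
    ≡⟨ ω-entry-product i j (lookup u (block i)) (lookup v (block j)) ⟨
  dot (tabulate (λ k → ω-entry i k (lookup u (block i))))
      (tabulate (λ k → ω-entry k j (lookup v (block j))))
    ≡⟨ cong₂ dot (row i) (col j) ⟨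
  dot (lookup (ω-diag u) i) (column (ω-diag v) j)
    ≡⟨ ⊗-entry (ω-diag u) (ω-diag v) i j ⟨
  (ω-diag u ⊗ ω-diag v) ⟨ i , j ⟩ ∎
  where
  open ≡-Reasoning
  row : ∀ i → lookup (ω-diag u) i ≡ tabulate (λ k → ω-entry i k (lookup u (block i)))
  row i = Vec-ext λ k → trans (ω-diag-entry u i k)
    (sym (lookup∘tabulate (λ k → ω-entry i k (lookup u (block i))) k))
  col : ∀ j → column (ω-diag v) j ≡ tabulate (λ k → ω-entry k j (lookup v (block j)))
  col j = tabulate-cong λ k →
    trans (ω-diag-entry v k j) (ω-entry-cong k j (lookup v (block k)) (lookup v (block j)) (cong (lookup v)))

ω-diag-zero : ω-diag 0̂ ≡ I₈
ω-diag-zero = Mat-ext λ i j → trans (ω-diag-entry 0̂ i j)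
  (trans (cong (ω-entry i j) (lookup-replicate (block i) zero)) (ω-entry-zero i j))

ω-diag-injective : ∀ {u v} → ω-diag u ≡ ω-diag v → u ≡ v
ω-diag-injective {u} {v} eq = Vec-ext λ h → ω-entry-faithful h (lookup u h) (lookup v h) λ a b →
  trans (sym (entry u h a b)) (trans (cong _⟨ at h a , at h b ⟩ eq) (entry v h a b))
  where
  entry : ∀ u h a b → ω-diag u ⟨ at h a , at h b ⟩ ≡ ω-entry (at h a) (at h b) (lookup u h)
  entry u h a b = trans (ω-diag-entry u (at h a) (at h b))
    (cong (λ k → ω-entry (at h a) (at h b) (lookup u k)) (block-at h a))

⊞-inverseʳ : ∀ u → u ⊞ map neg3 u ≡ 0̂
⊞-inverseʳ = decide (all-Code? λ u → ≡-dec-Vec _≟_ (u ⊞ map neg3 u) 0̂)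

⊞-comm : ∀ (u v : Code) → u ⊞ v ≡ v ⊞ u
⊞-comm = zipWith-comm (decide (all? λ x → all? λ y → add3 x y ≟ add3 y x))

⊞-cube : ∀ u → u ⊞ (u ⊞ u) ≡ 0̂
⊞-cube = decide (all-Code? λ u → ≡-dec-Vec _≟_ (u ⊞ (u ⊞ u)) 0̂)

ω-diag-blocks : ∀ u h → BlockEntries (ω-diag u) h h
ω-diag-blocks u h i j j∈h i∉h = trans (ω-diag-entry u i j)
  (ω-entry-off i j (lookup u (block i)) λ eq → i∉h (trans eq j∈h))

ω-diag-cancel : ∀ u v → u ⊞ v ≡ 0̂ → ω-diag u ⊗ ω-diag v ≡ I₈
ω-diag-cancel u v eq = trans (sym (ω-diag-⊞ u v)) (trans (cong ω-diag eq) ω-diag-zero)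

InGL4-ω-diag : ∀ u → InGL4 (ω-diag u)
InGL4-ω-diag u =
  (ω-diag -u , ⊗⇒·≡I right , ⊗⇒·≡I left) ,
  λ h → h , maps-onto (ω-diag u) (ω-diag -u) right (ω-diag-blocks u h) (ω-diag-blocks -u h)
  where
  -u = map neg3 u
  right = ω-diag-cancel u -u (⊞-inverseʳ u)
  left = ω-diag-cancel -u u (trans (⊞-comm -u u) (⊞-inverseʳ u))

ω-diag-fixes : ∀ u h → lookup u h ≡ zero → ∀ v → v ∈V h → ω-diag u ⊳ v ≡ v
ω-diag-fixes u h uh≡0 = fixes-block (ω-diag u) λ i j j∈h → trans (ω-diag-entry u i j)
  (trans (ω-entry-cong i j (lookup u (block i)) zero λ i~j →
            trans (cong (lookup u) (trans i~j j∈h)) uh≡0)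
         (ω-entry-zero i j))

fixed-⇒-entries : ∀ A k → (∀ v → v ∈V k → A ⊳ v ≡ v) →
                  ∀ i j → block j ≡ k → A ⟨ i , j ⟩ ≡ I₈ ⟨ i , j ⟩
fixed-⇒-entries A .(block j) fixed i j refl = begin
  A ⟨ i , j ⟩                  ≡⟨ ⊳-basis-entry A i j ⟨
  lookup (A ⊳ basis j) i       ≡⟨ cong (λ c → lookup c i) (fixed (basis j) (basis-∈V j)) ⟩
  lookup (basis j) i           ≡⟨ column-entry I₈ i j ⟩
  I₈ ⟨ i , j ⟩                 ∎
  where open ≡-Reasoning

ω-diag-fixes⁻¹ : ∀ u h → (∀ v → v ∈V h → ω-diag u ⊳ v ≡ v) → lookup u h ≡ zero
ω-diag-fixes⁻¹ u h fixed = ω-entry-faithful h (lookup u h) zero λ a b → begin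
  ω-entry (at h a) (at h b) (lookup u h)
    ≡⟨ cong (λ k → ω-entry (at h a) (at h b) (lookup u k)) (block-at h a) ⟨
  ω-entry (at h a) (at h b) (lookup u (block (at h a)))
    ≡⟨ ω-diag-entry u (at h a) (at h b) ⟨
  ω-diag u ⟨ at h a , at h b ⟩
    ≡⟨ fixed-⇒-entries (ω-diag u) h fixed (at h a) (at h b) (block-at h b) ⟩
  I₈ ⟨ at h a , at h b ⟩
    ≡⟨ ω-entry-zero (at h a) (at h b) ⟨
  ω-entry (at h a) (at h b) zero ∎
  where open ≡-Reasoning

⊞-decompose : ∀ a b c d → single zero a ⊞ (single (suc zero) b ⊞
  (single (suc (suc zero)) c ⊞ single (suc (suc (suc zero))) d)) ≡ a ∷ b ∷ c ∷ d ∷ []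
⊞-decompose = decide (all? λ a → all? λ b → all? λ c → all? λ d → ≡-dec-Vec _≟_ _ _)

ω-diag-product : ∀ a b c d →
  ω-diag (single zero a) ⊗ (ω-diag (single (suc zero) b) ⊗
    (ω-diag (single (suc (suc zero)) c) ⊗ ω-diag (single (suc (suc (suc zero))) d)))
  ≡ ω-diag (a ∷ b ∷ c ∷ d ∷ [])
ω-diag-product a b c d = begin
  A ⊗ (B ⊗ (C ⊗ D))
    ≡⟨ cong (λ X → A ⊗ (B ⊗ X)) (ω-diag-⊞ c' d') ⟨
  A ⊗ (B ⊗ ω-diag (c' ⊞ d'))
    ≡⟨ cong (A ⊗_) (ω-diag-⊞ b' (c' ⊞ d')) ⟨
  A ⊗ ω-diag (b' ⊞ (c' ⊞ d'))
    ≡⟨ ω-diag-⊞ a' (b' ⊞ (c' ⊞ d')) ⟨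
  ω-diag (a' ⊞ (b' ⊞ (c' ⊞ d')))
    ≡⟨ cong ω-diag (⊞-decompose a b c d) ⟩
  ω-diag (a ∷ b ∷ c ∷ d ∷ []) ∎
  where
  open ≡-Reasoning
  a' b' c' d' : Code
  a' = single zero a
  b' = single (suc zero) b
  c' = single (suc (suc zero)) c
  d' = single (suc (suc (suc zero))) d
  A B C D : Mat
  A = ω-diag a'
  B = ω-diag b'
  C = ω-diag c'
  D = ω-diag d'

InZ-ω-diag : ∀ h t → InZ h (ω-diag (single h t))
InZ-ω-diag h t =
  (InGL4-ω-diag s , λ k k≢h → ω-diag-fixes s k
    (trans (lookup∘update′ k≢h 0̂ t) (lookup-replicate k zero))) ,
  trans (sym (⊗-triple S S S))
    (trans (cong (S ⊗_) (sym (ω-diag-⊞ s s))) (ω-diag-cancel s (s ⊞ s) (⊞-cube s)))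
  where
  s = single h t
  S = ω-diag s

InG81-ω-diag : ∀ u → InG81 (ω-diag u)
InG81-ω-diag (a ∷ b ∷ c ∷ d ∷ []) =
  A , B , C , D ,
  InZ-ω-diag zero a , InZ-ω-diag (suc zero) b , InZ-ω-diag (suc (suc zero)) c ,
  InZ-ω-diag (suc (suc (suc zero))) d ,
  trans (sym (ω-diag-product a b c d)) (⊗-quadruple A B C D)
  where
  A B C D : Mat
  A = ω-diag (single zero a)
  B = ω-diag (single (suc zero) b)
  C = ω-diag (single (suc (suc zero)) c)
  D = ω-diag (single (suc (suc (suc zero))) d)

-- Every element of Z_h is a power of ω on block h.

-- The shape forced on a matrix that preserves V_h and fixes the other blocks pointwise. It leaves a
-- single 2 × 2 block undetermined, hence 16 candidates for each h.
padded-entry : Fin 4 → Vec (Vec F₂ 2) 2 → Fin 8 → Fin 8 → F₂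
padded-entry h M i j =
  if does (block j ≟ h)
  then (if does (block i ≟ h) then lookup (lookup M (parity i)) (parity j) else false)
  else I₈ ⟨ i , j ⟩

padded-in : ∀ h M i j → block i ≡ h → block j ≡ h →
            padded-entry h M i j ≡ lookup (lookup M (parity i)) (parity j)
padded-in h M i j i∈h j∈h
  rewrite dec-true (block j ≟ h) j∈h | dec-true (block i ≟ h) i∈h = refl

padded-below : ∀ h M i j → block i ≢ h → block j ≡ h → padded-entry h M i j ≡ false
padded-below h M i j i∉h j∈h
  rewrite dec-true (block j ≟ h) j∈h | dec-false (block i ≟ h) i∉h = refl

padded-out : ∀ h M i j → block j ≢ h → padded-entry h M i j ≡ I₈ ⟨ i , j ⟩
padded-out h M i j j∉h rewrite dec-false (block j ≟ h) j∉h = refl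

_≟ᴹ_ : (A B : Mat) → Dec (A ≡ B)
_≟ᴹ_ = ≡-dec-Vec (≡-dec-Vec _≟ᵇ_)

opaque
  padded : Fin 4 → Vec (Vec F₂ 2) 2 → Mat
  padded h M = matrix (padded-entry h M)

  padded-⟨⟩ : ∀ h M i j → padded h M ⟨ i , j ⟩ ≡ padded-entry h M i j
  padded-⟨⟩ h M = matrix-entry (padded-entry h M)

opaque
  unfolding padded ω-diag _⊗_

  -- In GL(2,2) ≅ Sym(3) the solutions of M³ = 1 are the powers of ω.
  padded-cube-root : ∀ h M → padded h M ⊗ (padded h M ⊗ padded h M) ≡ I₈ →
                     ∃[ t ] padded h M ≡ ω-diag (single h t)
  padded-cube-root = decide (all? λ h → all-Vec? (all-Vec? all-Bool? 2) 2 λ M →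
    ((padded h M ⊗ (padded h M ⊗ padded h M)) ≟ᴹ I₈) →-dec
    (any? λ t → padded h M ≟ᴹ ω-diag (single h t)))

-- Suppose `g` carried V_h into V_k with k ≠ h. Then `g` would fix `g ⊳ v`, and injectivity would
-- give `g ⊳ v ≡ v`, which puts `g ⊳ v` in V_h after all.
InZ⇒maps-to-itself : ∀ h g → InZ h g → ∀ v → v ∈V h → (g ⊳ v) ∈V h
InZ⇒maps-to-itself h g (((inv , blocks) , fixes) , _) v v∈h = by-cases (k ≟ h)
  where
  k : Fin 4
  k = proj₁ (blocks h)
  gv∈k : (g ⊳ v) ∈V k
  gv∈k = proj₁ (proj₂ (blocks h)) v v∈h
  by-cases : Dec (k ≡ h) → (g ⊳ v) ∈V h
  by-cases (yes k≡h) = subst ((g ⊳ v) ∈V_) k≡h gv∈k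
  by-cases (no k≢h) = subst (_∈V h)
    (⊳-injective {g} inv {v} {g ⊳ v} (sym (fixes k k≢h (g ⊳ v) gv∈k))) v∈h

InZ⇒ω-diag : ∀ h g → InZ h g → ∃[ t ] g ≡ ω-diag (single h t)
InZ⇒ω-diag h g z@((_ , fixes) , cube) =
  let (t , eq) = padded-cube-root h M
        (subst (λ X → X ⊗ (X ⊗ X) ≡ I₈) g≡padded (trans (⊗-triple g g g) cube))
  in t , trans g≡padded eq
  where
  row : Fin 2 → Vec F₂ 2
  row a = tabulate λ b → g ⟨ at h a , at h b ⟩

  M : Vec (Vec F₂ 2) 2
  M = tabulate row

  inside : ∀ i j → block i ≡ h → block j ≡ h → g ⟨ i , j ⟩ ≡ padded-entry h M i j
  inside i j i∈h j∈h = begin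
    g ⟨ i , j ⟩
      ≡⟨ cong₂ (λ a b → g ⟨ a , b ⟩) (at-parity i) (at-parity j) ⟨
    g ⟨ at (block i) (parity i) , at (block j) (parity j) ⟩
      ≡⟨ cong₂ (λ a b → g ⟨ at a (parity i) , at b (parity j) ⟩) i∈h j∈h ⟩
    g ⟨ at h (parity i) , at h (parity j) ⟩
      ≡⟨ lookup∘tabulate (λ b → g ⟨ at h (parity i) , at h b ⟩) (parity j) ⟨
    lookup (row (parity i)) (parity j)
      ≡⟨ cong (λ r → lookup r (parity j)) (lookup∘tabulate row (parity i)) ⟨
    lookup (lookup M (parity i)) (parity j)
      ≡⟨ padded-in h M i j i∈h j∈h ⟨
    padded-entry h M i j ∎
    where open ≡-Reasoning

  entry : ∀ i j → Dec (block j ≡ h) → Dec (block i ≡ h) → g ⟨ i , j ⟩ ≡ padded-entry h M i j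
  entry i j (no j∉h) _ =
    trans (fixed-⇒-entries g (block j) (fixes (block j) j∉h) i j refl)
          (sym (padded-out h M i j j∉h))
  entry i j (yes j∈h) (yes i∈h) = inside i j i∈h j∈h
  entry i j (yes j∈h) (no i∉h) = trans (sym (⊳-basis-entry g i j))
    (trans (InZ⇒maps-to-itself h g z (basis j) (subst (basis j ∈V_) j∈h (basis-∈V j)) i i∉h)
           (sym (padded-below h M i j i∉h j∈h)))

  g≡padded : g ≡ padded h M
  g≡padded = Mat-ext λ i j → trans (entry i j (block j ≟ h) (block i ≟ h)) (sym (padded-⟨⟩ h M i j))

InG81⇒ω-diag : ∀ {g} → InG81 g → ∃[ u ] ω-diag u ≡ g
InG81⇒ω-diag {g} (A , B , C , D , zA , zB , zC , zD , g≡) =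
  let (a , eqA) = InZ⇒ω-diag zero A zA ; (b , eqB) = InZ⇒ω-diag (suc zero) B zB
      (c , eqC) = InZ⇒ω-diag (suc (suc zero)) C zC ; (d , eqD) = InZ⇒ω-diag (suc (suc (suc zero))) D zD in
  (a ∷ b ∷ c ∷ d ∷ []) ,
  trans (sym (ω-diag-product a b c d))
    (trans (sym (cong₂ _⊗_ eqA (cong₂ _⊗_ eqB (cong₂ _⊗_ eqC eqD))))
           (trans (⊗-quadruple A B C D) (sym g≡)))

-- Planes of F₃⁴ and their reduced row echelon forms.

all-Z3²? : Exhaustible Z3×Z3
all-Z3²? = all-Σ? all? λ _ → all?

any-Z3²? : ∀ {P : Z3×Z3 → Set} → Decidable P → Dec (∃ P)
any-Z3²? P? = map′ (λ (c , d , p) → (c , d) , p) (λ ((c , d) , p) → c , d , p)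
                   (any? λ c → any? λ d → P? (c , d))

_≟ᶜ_ : ∀ {n} (u v : Vec (Fin 3) n) → Dec (u ≡ v)
_≟ᶜ_ = ≡-dec-Vec _≟_

_≟²_ : (p q : Z3×Z3) → Dec (p ≡ q)
_≟²_ = ≡-dec-Σ _≟_ _≟_

comb : ∀ {n} → Vec (Fin 3) n × Vec (Fin 3) n → Z3×Z3 → Vec (Fin 3) n
comb (u , v) (c , d) = map (mul3 c) u ⊞ map (mul3 d) v

-- Linear combinations act coordinate by coordinate, so an identity about them needs checking only
-- for scalars. This is why `comb` is stated for every length `n`.
comb-⊕ : ∀ {n} (R : Vec (Fin 3) n × Vec (Fin 3) n) p q → comb R (p ⊕ q) ≡ comb R p ⊞ comb R q
comb-⊕ ([] , []) p q = refl
comb-⊕ (x ∷ u , y ∷ v) p q = cong₂ _∷_ (scalar p q x y) (comb-⊕ (u , v) p q)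
  where
  scalar : ∀ (p q : Z3×Z3) x y →
    add3 (mul3 (proj₁ (p ⊕ q)) x) (mul3 (proj₂ (p ⊕ q)) y) ≡
    add3 (add3 (mul3 (proj₁ p) x) (mul3 (proj₂ p) y)) (add3 (mul3 (proj₁ q) x) (mul3 (proj₂ q) y))
  scalar = decide (all-Z3²? λ p → all-Z3²? λ q → all? λ x → all? λ y → _ ≟ _)

-- The product of a row of coefficients with the 2 × 2 matrix whose rows are the given pairs, that
-- is, a change of spanning pair.
comb² : Z3×Z3 × Z3×Z3 → Z3×Z3 → Z3×Z3
comb² ((a , b) , (a' , b')) (c , d) = add3 (mul3 c a) (mul3 d a') , add3 (mul3 c b) (mul3 d b')

comb-comb : ∀ {n} (R : Vec (Fin 3) n × Vec (Fin 3) n) p q r →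
            comb (comb R p , comb R q) r ≡ comb R (comb² (p , q) r)
comb-comb ([] , []) p q r = refl
comb-comb (x ∷ u , y ∷ v) p q r = cong₂ _∷_ (scalar p q r x y) (comb-comb (u , v) p q r)
  where
  scalar : ∀ (p q r : Z3×Z3) x y →
    add3 (mul3 (proj₁ r) (add3 (mul3 (proj₁ p) x) (mul3 (proj₂ p) y)))
         (mul3 (proj₂ r) (add3 (mul3 (proj₁ q) x) (mul3 (proj₂ q) y))) ≡
    add3 (mul3 (proj₁ (comb² (p , q) r)) x) (mul3 (proj₂ (comb² (p , q) r)) y)
  scalar = decide (all-Z3²? λ p → all-Z3²? λ q → all-Z3²? λ r → all? λ x → all? λ y → _ ≟ _)

-- The number of free entries for each choice of two pivot columns. The number of planes is 3⁴ + 3³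
-- + 3² + 3² + 3 + 1 = 130.
free : Fin 6 → ℕ
free = lookup (4 ∷ 3 ∷ 2 ∷ 2 ∷ 1 ∷ 0 ∷ [])

pivots : Fin 6 → Fin 4 × Fin 4
pivots = lookup
  ((# 0 , # 1) ∷ (# 0 , # 2) ∷ (# 0 , # 3) ∷ (# 1 , # 2) ∷ (# 1 , # 3) ∷ (# 2 , # 3) ∷ [])

Echelon : Set
Echelon = Σ (Fin 6) λ k → Vec (Fin 3) (free k)

all-Echelon? : Exhaustible Echelon
all-Echelon? = all-Σ? all? λ k → all-Vec? all? (free k)

_≟ᴱ_ : (e e' : Echelon) → Dec (e ≡ e')
_≟ᴱ_ = ≡-dec-Σ _≟_ _≟ᶜ_

pattern O = zero
pattern I = suc zero

rows : Echelon → Code × Code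
rows (zero , a ∷ b ∷ c ∷ d ∷ []) = (I ∷ O ∷ a ∷ b ∷ []) , (O ∷ I ∷ c ∷ d ∷ [])
rows (suc zero , a ∷ b ∷ c ∷ []) = (I ∷ a ∷ O ∷ b ∷ []) , (O ∷ O ∷ I ∷ c ∷ [])
rows (suc (suc zero) , a ∷ b ∷ []) = (I ∷ a ∷ b ∷ O ∷ []) , (O ∷ O ∷ O ∷ I ∷ [])
rows (suc (suc (suc zero)) , a ∷ b ∷ []) = (O ∷ I ∷ O ∷ a ∷ []) , (O ∷ O ∷ I ∷ b ∷ [])
rows (suc (suc (suc (suc zero))) , a ∷ []) = (O ∷ I ∷ a ∷ O ∷ []) , (O ∷ O ∷ O ∷ I ∷ [])
rows (suc (suc (suc (suc (suc zero)))) , []) = (O ∷ O ∷ I ∷ O ∷ []) , (O ∷ O ∷ O ∷ I ∷ [])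

freeEntries : ∀ k → Code × Code → Vec (Fin 3) (free k)
freeEntries zero ((_ ∷ _ ∷ a ∷ b ∷ []) , (_ ∷ _ ∷ c ∷ d ∷ [])) = a ∷ b ∷ c ∷ d ∷ []
freeEntries (suc zero) ((_ ∷ a ∷ _ ∷ b ∷ []) , (_ ∷ _ ∷ _ ∷ c ∷ [])) = a ∷ b ∷ c ∷ []
freeEntries (suc (suc zero)) ((_ ∷ a ∷ b ∷ _ ∷ []) , _) = a ∷ b ∷ []
freeEntries (suc (suc (suc zero))) ((_ ∷ _ ∷ _ ∷ a ∷ []) , (_ ∷ _ ∷ _ ∷ b ∷ [])) = a ∷ b ∷ []
freeEntries (suc (suc (suc (suc zero)))) ((_ ∷ _ ∷ a ∷ _ ∷ []) , _) = a ∷ []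
freeEntries (suc (suc (suc (suc (suc zero))))) _ = []

minor : Fin 6 → Code × Code → Fin 3
minor k (u , v) = let (p , q) = pivots k in
  add3 (mul3 (lookup u p) (lookup v q)) (neg3 (mul3 (lookup u q) (lookup v p)))

-- Cramer's rule; every nonzero scalar of F₃ is its own inverse.
reduceAt : Fin 6 → Code × Code → Code × Code
reduceAt k (u , v) =
  comb (u , v) (mul3 δ (lookup v q) , neg3 (mul3 δ (lookup u q))) ,
  comb (u , v) (neg3 (mul3 δ (lookup v p)) , mul3 δ (lookup u p))
  where
  p = proj₁ (pivots k)
  q = proj₂ (pivots k)
  δ = minor k (u , v)

-- The first nonvanishing minor in lexicographic order sits at the pivot columns.
echelonForm : Code × Code → Maybe Echelon
echelonForm R = map-Maybe (λ k → k , freeEntries k (reduceAt k R))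
  (head (filter (λ k → ¬? (minor k R ≟ zero)) (allFin 6)))

InSpan : Code → Code × Code → Set
InSpan u R = ∃[ p ] u ≡ comb R p

inSpan? : ∀ u R → Dec (InSpan u R)
inSpan? u R = any-Z3²? λ p → u ≟ᶜ comb R p

SpanIncluded : Code × Code → Code × Code → Set
SpanIncluded (u , v) R = InSpan u R × InSpan v R

spanIncluded? : ∀ R S → Dec (SpanIncluded R S)
spanIncluded? (u , v) S = inSpan? u S ×-dec inSpan? v S

Dependent : Code × Code → Set
Dependent R = ∃[ p ] p ≢ (zero , zero) × comb R p ≡ 0̂

-- The value `nothing` arises when all six minors vanish, which is the case of rank below two.
HasEchelonForm : Code × Code → Maybe Echelon → Set
HasEchelonForm R (just e) = SpanIncluded R (rows e) × SpanIncluded (rows e) R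
HasEchelonForm R nothing = Dependent R

hasEchelonForm? : ∀ R m → Dec (HasEchelonForm R m)
hasEchelonForm? R (just e) = spanIncluded? R (rows e) ×-dec spanIncluded? (rows e) R
hasEchelonForm? R nothing = any-Z3²? λ p → ¬? (p ≟² (zero , zero)) ×-dec (comb R p ≟ᶜ 0̂)

abstract
  echelonForm-correct : ∀ R → HasEchelonForm R (echelonForm R)
  echelonForm-correct = decide (all-Σ? all-Code? (λ _ → all-Code?) λ R →
    hasEchelonForm? R (echelonForm R))

  -- On the pivot columns the rows form the identity matrix, so the coefficients of a combination
  -- can be read off there.
  comb-rows-pivots : ∀ e p →
    (lookup (comb (rows e) p) (proj₁ (pivots (proj₁ e))) ,
     lookup (comb (rows e) p) (proj₂ (pivots (proj₁ e)))) ≡ p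
  comb-rows-pivots = decide (all-Echelon? λ e → all-Z3²? λ p → _ ≟² p)

  echelonForm-rows : ∀ e → echelonForm (rows e) ≡ just e
  echelonForm-rows = decide (all-Echelon? λ e → ≡-dec-Maybe _≟ᴱ_ (echelonForm (rows e)) (just e))

  -- An independent pair inside a plane spans it and hence reduces to the same form. For a dependent
  -- pair the reduction returns `nothing` and `All` holds vacuously.
  echelonForm-unique : ∀ e p q →
    MaybeAll.All (_≡ e) (echelonForm (comb (rows e) p , comb (rows e) q))
  echelonForm-unique = decide (all-Echelon? λ e → all-Z3²? λ p → all-Z3²? λ q →
    MaybeAll.dec (_≟ᴱ e) _)

comb-rows-injective : ∀ e {p q} → comb (rows e) p ≡ comb (rows e) q → p ≡ q
comb-rows-injective e {p} {q} eq =
  trans (sym (comb-rows-pivots e p))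
    (trans (cong (λ u → lookup u (proj₁ (pivots (proj₁ e))) , lookup u (proj₂ (pivots (proj₁ e)))) eq)
           (comb-rows-pivots e q))

-- One inclusion suffices, since both spans are planes: the rows of `e` are combinations of those of
-- `e'`, so they reduce to `e'`, and they also reduce to `e`.
rows-included⇒≡ : ∀ e e' → SpanIncluded (rows e) (rows e') → e ≡ e'
rows-included⇒≡ e e' ((p , eq₁) , (q , eq₂)) = MaybeAll.drop-just
  (subst (MaybeAll.All (_≡ e')) (trans (cong echelonForm (sym (cong₂ _,_ eq₁ eq₂))) (echelonForm-rows e))
         (echelonForm-unique e' p q))

InSpan-trans : ∀ {u R S} → SpanIncluded R S → InSpan u R → InSpan u S
InSpan-trans {S = S} ((p , eq₁) , (q , eq₂)) (r , eq) =
  comb² (p , q) r ,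
  trans eq (trans (cong₂ (λ x y → comb (x , y) r) eq₁ eq₂) (comb-comb S p q r))

-- Enumeration of the echelon forms.

ternaryVecs : ∀ n → List (Vec (Fin 3) n)
ternaryVecs ℕ.zero = [] ∷ []
ternaryVecs (ℕ.suc n) = cartesianProductWith _∷_ (allFin 3) (ternaryVecs n)

∈-ternaryVecs : ∀ {n} (v : Vec (Fin 3) n) → v ∈ ternaryVecs n
∈-ternaryVecs [] = here refl
∈-ternaryVecs (x ∷ v) = ∈-cartesianProductWith⁺ _∷_ (∈-allFin x) (∈-ternaryVecs v)

echelons : List Echelon
echelons = concatMap (λ k → List.map (k ,_) (ternaryVecs (free k))) (allFin 6)

∈-echelons : ∀ e → e ∈ echelons
∈-echelons (k , v) = ∈-concatMap⁺ (λ k → List.map (k ,_) (ternaryVecs (free k)))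
  (lose (∈-allFin k) (∈-map⁺ (k ,_) (∈-ternaryVecs v)))

opaque
  echelonAt : Fin 130 → Echelon
  -- That this has domain `Fin 130` is the count itself: the length of `echelons` evaluates to 130.
  echelonAt = List.lookup echelons

  position : Echelon → Fin 130
  position e = index (∈-echelons e)

  echelonAt-position : ∀ e → echelonAt (position e) ≡ e
  echelonAt-position e = sym (lookup-index (∈-echelons e))

  -- This says that the list has no repetitions, which makes distinct indices give distinct
  -- subgroups.
  position-echelonAt : ∀ i → position (echelonAt i) ≡ i
  position-echelonAt = decide (all? λ i → position (echelonAt i) ≟ i)

-- Hamming weights and the class of a plane.

support : Code → Subset₀ 4
support = map (λ t → does (¬? (t ≟ zero)))

weight : Code → ℕ
weight u = ∣ support u ∣

HasWeight : Code × Code → ℕ → Set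
HasWeight R w = ∃[ p ] weight (comb R p) ≡ w

hasWeight? : ∀ R w → Dec (HasWeight R w)
hasWeight? R w = any-Z3²? λ p → weight (comb R p) ≟ⁿ w

-- The seven classes have the nonzero weights
-- {1,2}, {1,2,3}, {1,3,4}, {2,4}, {2,3}, {2,3,4}, {3}.
classOfWeights : (w₁ w₂ w₃ w₄ : Bool) → Fin 7
classOfWeights true true false _ = # 0
classOfWeights true true true _ = # 1
classOfWeights true false _ _ = # 2
classOfWeights false true false _ = # 3
classOfWeights false true true false = # 4
classOfWeights false true true true = # 5
classOfWeights false false _ _ = # 6

class : Echelon → Fin 7
class e = classOfWeights (has 1) (has 2) (has 3) (has 4)
  where
  has : ℕ → Bool
  has w = does (hasWeight? (rows e) w)

class-cong : ∀ e e' → (∀ w → HasWeight (rows e) w ⇔ HasWeight (rows e') w) → class e ≡ class e'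
class-cong e e' same = has-cong (has≡ 1) (has≡ 2) (has≡ 3) (has≡ 4)
  where
  has≡ : ∀ w → does (hasWeight? (rows e) w) ≡ does (hasWeight? (rows e') w)
  has≡ w = does-⇔ (same w) (hasWeight? (rows e) w) (hasWeight? (rows e') w)
  has-cong : ∀ {a b c d a' b' c' d'} → a ≡ a' → b ≡ b' → c ≡ c' → d ≡ d' →
             classOfWeights a b c d ≡ classOfWeights a' b' c' d'
  has-cong refl refl refl refl = refl

-- The permutation is given by its vector of values because vectors, unlike functions, can be
-- enumerated.
∣∣-permute : ∀ (π : Vec (Fin 4) 4) → (∀ h k → lookup π h ≡ lookup π k → h ≡ k) →
             ∀ (z : Subset₀ 4) → ∣ tabulate (λ h → lookup z (lookup π h)) ∣ ≡ ∣ z ∣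
∣∣-permute = decide (all-Vec? all? 4 λ π →
  (all? λ h → all? λ k → (lookup π h ≟ lookup π k) →-dec (h ≟ k)) →-dec
  (all-Vec? all-Bool? 4 λ z → ∣ tabulate (λ h → lookup z (lookup π h)) ∣ ≟ⁿ ∣ z ∣))

weight-permute : ∀ (π : Fin 4 → Fin 4) → (∀ h k → π h ≡ π k → h ≡ k) → ∀ u v →
                 (∀ h → lookup u h ≡ zero ⇔ lookup v (π h) ≡ zero) → weight u ≡ weight v
weight-permute π π-injective u v same = begin
  ∣ support u ∣
    ≡⟨ cong ∣_∣ (Vec-ext {u = support u} {tabulate permuted} pointwise) ⟩
  ∣ tabulate permuted ∣
    ≡⟨ ∣∣-permute πᵛ injective (support v) ⟩
  ∣ support v ∣ ∎
  where
  open ≡-Reasoning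
  πᵛ : Vec (Fin 4) 4
  πᵛ = tabulate π
  permuted : Fin 4 → Bool
  permuted h = lookup (support v) (lookup πᵛ h)
  injective : ∀ h k → lookup πᵛ h ≡ lookup πᵛ k → h ≡ k
  injective h k eq = π-injective h k
    (trans (sym (lookup∘tabulate π h)) (trans eq (lookup∘tabulate π k)))
  support-lookup : ∀ u h → lookup (support u) h ≡ does (¬? (lookup u h ≟ zero))
  support-lookup u h = lookup-map h (λ t → does (¬? (t ≟ zero))) u
  pointwise : ∀ h → lookup (support u) h ≡
                    lookup (tabulate permuted) h
  pointwise h = begin
    lookup (support u) h
      ≡⟨ support-lookup u h ⟩
    does (¬? (lookup u h ≟ zero))
      ≡⟨ cong not (does-⇔ (same h) (lookup u h ≟ zero) (lookup v (π h) ≟ zero)) ⟩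
    does (¬? (lookup v (π h) ≟ zero))
      ≡⟨ support-lookup v (π h) ⟨
    lookup (support v) (π h)
      ≡⟨ cong (lookup (support v)) (lookup∘tabulate π h) ⟨
    lookup (support v) (lookup πᵛ h)
      ≡⟨ lookup∘tabulate permuted h ⟨
    lookup (tabulate permuted) h ∎

-- Block transpositions and sign changes.

data Generator : Set where
  swap : Fin 4 → Fin 4 → Generator
  flip : Fin 4 → Generator

all-Generator? : Exhaustible Generator
all-Generator? P? = map′ (λ { (f , g) (swap h k) → f h k ; (f , g) (flip h) → g h })
                         (λ f → (λ h k → f (swap h k)) , λ h → f (flip h))
                         ((all? λ h → all? λ k → P? (swap h k)) ×-dec (all? λ h → P? (flip h)))

generators : List Generator
generators = cartesianProductWith swap (allFin 4) (allFin 4) ++ List.map flip (allFin 4)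

blockMap : Generator → Fin 4 → Fin 4
blockMap (swap h k) = transpose h k
blockMap (flip h) = id

basisMap : Generator → Fin 8 → Fin 8
basisMap (swap h k) i = at (transpose h k (block i)) (parity i)
basisMap (flip h) i =
  if does (block i ≟ h) then at (block i) (opposite (parity i)) else i

twist : Generator → Fin 4 → Fin 3 → Fin 3
twist (swap _ _) _ = id
twist (flip h) k = if does (k ≟ h) then neg3 else id

act : Generator → Code → Code
act s u = tabulate (λ h → twist s h (lookup u (blockMap s h)))

generatorMat : Generator → Mat
generatorMat s = permutationMat (basisMap s)

abstract
  basisMap-involutive : ∀ s i → basisMap s (basisMap s i) ≡ i
  basisMap-involutive = decide (all-Generator? λ s → all? λ i → basisMap s (basisMap s i) ≟ i)

  block-basisMap : ∀ s i → block (basisMap s i) ≡ blockMap s (block i)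
  block-basisMap = decide (all-Generator? λ s → all? λ i →
    block (basisMap s i) ≟ blockMap s (block i))

  -- Swapping the two basis vectors of a block conjugates ω to ω².
  ω-entry-basisMap : ∀ s i j t →
    ω-entry (basisMap s i) j t ≡ ω-entry i (basisMap s j) (twist s (block i) t)
  ω-entry-basisMap = decide (all-Generator? λ s → all? λ i → all? λ j → all? λ t →
    ω-entry (basisMap s i) j t ≟ᵇ ω-entry i (basisMap s j) (twist s (block i) t))

  generatorMat-blocks : ∀ s h → BlockEntries (generatorMat s) h (blockMap s h) ×
                                BlockEntries (generatorMat s) (blockMap s h) h
  generatorMat-blocks = decide (all-Generator? λ s → all? λ h →
    blockEntries? (generatorMat s) h (blockMap s h) ×-dec
    blockEntries? (generatorMat s) (blockMap s h) h)

  act-involutive : ∀ s u → act s (act s u) ≡ u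
  act-involutive = decide (all-Generator? λ s → all-Code? λ u → act s (act s u) ≟ᶜ u)

-- Both products merely reindex an ω-diagonal matrix, by rows on the left and by columns on the
-- right, so the claim reduces to the entry identity `ω-entry-basisMap`.
generatorMat-conjugates : ∀ s u → generatorMat s ⊗ ω-diag u ≡ ω-diag (act s u) ⊗ generatorMat s
generatorMat-conjugates s u = Mat-ext λ i j → begin
  (generatorMat s ⊗ ω-diag u) ⟨ i , j ⟩
    ≡⟨ permutationMat-⊗ˡ σ (ω-diag u) i j ⟩
  ω-diag u ⟨ σ i , j ⟩
    ≡⟨ ω-diag-entry u (σ i) j ⟩
  ω-entry (σ i) j (lookup u (block (σ i)))
    ≡⟨ cong (λ h → ω-entry (σ i) j (lookup u h)) (block-basisMap s i) ⟩
  ω-entry (σ i) j (lookup u (blockMap s (block i)))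
    ≡⟨ ω-entry-basisMap s i j (lookup u (blockMap s (block i))) ⟩
  ω-entry i (σ j) (twist s (block i) (lookup u (blockMap s (block i))))
    ≡⟨ cong (ω-entry i (σ j)) (lookup∘tabulate (λ h → twist s h (lookup u (blockMap s h))) (block i)) ⟨
  ω-entry i (σ j) (lookup (act s u) (block i))
    ≡⟨ ω-diag-entry (act s u) i (σ j) ⟨
  ω-diag (act s u) ⟨ i , σ j ⟩
    ≡⟨ permutationMat-⊗ʳ σ (basisMap-involutive s) (ω-diag (act s u)) i j ⟨
  (ω-diag (act s u) ⊗ generatorMat s) ⟨ i , j ⟩ ∎
  where
  open ≡-Reasoning
  σ : Fin 8 → Fin 8
  σ = basisMap s

generatorMat-involutive : ∀ s → generatorMat s ⊗ generatorMat s ≡ I₈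
generatorMat-involutive s = Mat-ext λ i j →
  trans (permutationMat-⊗ˡ (basisMap s) (generatorMat s) i j)
    (trans (matrix-entry (λ i j → I₈ ⟨ basisMap s i , j ⟩) (basisMap s i) j)
           (cong (λ k → I₈ ⟨ k , j ⟩) (basisMap-involutive s i)))

InGL4-generatorMat : ∀ s → InGL4 (generatorMat s)
InGL4-generatorMat s =
  (generatorMat s , ⊗⇒·≡I {generatorMat s} {generatorMat s} (generatorMat-involutive s)
                  , ⊗⇒·≡I {generatorMat s} {generatorMat s} (generatorMat-involutive s)) ,
  λ h → blockMap s h , maps-onto (generatorMat s) (generatorMat s) (generatorMat-involutive s)
    (proj₁ (generatorMat-blocks s h)) (proj₂ (generatorMat-blocks s h))

-- Descent to the representatives.

-- A lexicographic order: at most four ternary digits give a value below 81, so the pivot columns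
-- count before the free entries.
rank : Echelon → ℕ
rank (k , v) = toℕ k * 81 + foldl (λ _ → ℕ) (λ n t → 3 * n + toℕ t) 0 v

-- The element of least rank in each class.
representative : Fin 7 → Echelon
representative c = # 0 , lookup
  ((O ∷ O ∷ O ∷ O ∷ []) ∷ (O ∷ O ∷ O ∷ I ∷ []) ∷ (O ∷ O ∷ I ∷ I ∷ []) ∷ (O ∷ I ∷ I ∷ O ∷ []) ∷
   (O ∷ I ∷ O ∷ I ∷ []) ∷ (O ∷ I ∷ I ∷ I ∷ []) ∷ (I ∷ I ∷ I ∷ # 2 ∷ []) ∷ []) c

-- The two halves match the two clauses of `ConjugateInGL4`. Both come out of the same finite check,
-- so no dimension argument enters.
MapsSpan : Generator → Echelon → Echelon → Set
MapsSpan s e e' = (∀ p → InSpan (act s (comb (rows e) p)) (rows e')) ×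
                  (∀ q → ∃[ p ] act s (comb (rows e) p) ≡ comb (rows e') q)

mapsSpan? : ∀ s e e' → Dec (MapsSpan s e e')
mapsSpan? s e e' =
  (all-Z3²? λ p → inSpan? (act s (comb (rows e) p)) (rows e')) ×-dec
  (all-Z3²? λ q → any-Z3²? λ p → act s (comb (rows e) p) ≟ᶜ comb (rows e') q)

image : Generator → Echelon → Maybe Echelon
image s e = echelonForm (act s (proj₁ (rows e)) , act s (proj₂ (rows e)))

Descends : Echelon → Set
Descends e = Any (λ s → MaybeAny.Any (λ e' → rank e' < rank e × MapsSpan s e e') (image s e)) generators

abstract
  -- One generator per form is enough, so 20 candidates are tried for each of the 130 forms and no
  -- search for a conjugator to the representative is made.
  descent : ∀ e → e ≡ representative (class e) ⊎ Descends e
  descent = decide (all-Echelon? λ e → (e ≟ᴱ representative (class e)) ⊎-dec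
    any-List? (λ s → MaybeAny.dec (λ e' → (rank e' <? rank e) ×-dec mapsSpan? s e e') (image s e)) generators)

Decreases : Echelon → Set
Decreases e = ∃[ s ] ∃[ e' ] rank e' < rank e × MapsSpan s e e'

Descends⇒Decreases : ∀ {e} → Descends e → Decreases e
Descends⇒Decreases d with satisfied d
... | s , m with MaybeAny.satisfied m
...   | e' , found = s , e' , found

MapsSpan-sym : ∀ s e e' → MapsSpan s e e' → MapsSpan s e' e
MapsSpan-sym s e e' (to , from) =
  (λ q → let (p , eq) = from q in p , back p q eq) ,
  (λ p → let (q , eq) = to p in q , back p q eq)
  where
  back : ∀ p q → act s (comb (rows e) p) ≡ comb (rows e') q →
         act s (comb (rows e') q) ≡ comb (rows e) p
  back p q eq = trans (cong (act s) (sym eq)) (act-involutive s (comb (rows e) p))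

opaque
  unfolding echelonAt

  class-size : ∀ c → fiberSize (λ i → class (echelonAt i)) c ≡
                     lookup (6 ∷ 24 ∷ 16 ∷ 12 ∷ 16 ∷ 48 ∷ 8 ∷ []) c
  class-size = decide (all? λ c → fiberSize (λ i → class (echelonAt i)) c ≟ⁿ
                                    lookup (6 ∷ 24 ∷ 16 ∷ 12 ∷ 16 ∷ 48 ∷ 8 ∷ []) c)

-- Subgroups isomorphic to Z₃ × Z₃ as row spaces.

comb-10 : ∀ {n} (u v : Vec (Fin 3) n) → comb (u , v) (I , O) ≡ u
comb-10 [] [] = refl
comb-10 (x ∷ u) (y ∷ v) = cong₂ _∷_ (add3-identityʳ x) (comb-10 u v)
  where
  add3-identityʳ : ∀ x → add3 x O ≡ x
  add3-identityʳ = decide (all? λ x → add3 x O ≟ x)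

comb-01 : ∀ {n} (u v : Vec (Fin 3) n) → comb (u , v) (O , I) ≡ v
comb-01 [] [] = refl
comb-01 (x ∷ u) (y ∷ v) = cong (y ∷_) (comb-01 u v)

comb-00 : ∀ {n} (u v : Vec (Fin 3) n) → comb (u , v) (O , O) ≡ replicate n O
comb-00 [] [] = refl
comb-00 (x ∷ u) (y ∷ v) = cong (O ∷_) (comb-00 u v)

-- Over the prime field F₃ an additive map is linear, since every coefficient is a repeated sum of
-- ones.
additive⇒comb : ∀ (τ : Z3×Z3 → Code) → (∀ p q → τ (p ⊕ q) ≡ τ p ⊞ τ q) →
                ∀ p → τ p ≡ comb (τ (I , O) , τ (O , I)) p
additive⇒comb τ τ-⊕ (c , d) =
  subst Agree (⊕-split c d) (agree-⊕ (c , O) (O , d) (first c) (second d))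
  where
  U V : Code
  U = τ (I , O)
  V = τ (O , I)
  Agree : Z3×Z3 → Set
  Agree p = τ p ≡ comb (U , V) p
  agree-⊕ : ∀ p q → Agree p → Agree q → Agree (p ⊕ q)
  agree-⊕ p q ap aq = trans (τ-⊕ p q) (trans (cong₂ _⊞_ ap aq) (sym (comb-⊕ (U , V) p q)))
  one : Agree (I , O)
  one = sym (comb-10 U V)
  one' : Agree (O , I)
  one' = sym (comb-01 U V)
  two : Agree (# 2 , O)
  two = agree-⊕ (I , O) (I , O) one one
  two' : Agree (O , # 2)
  two' = agree-⊕ (O , I) (O , I) one' one'
  first : ∀ c → Agree (c , O)
  -- Zero is written as 1 + 2, so that additivity yields the value at zero too.
  first O = agree-⊕ (I , O) (# 2 , O) one two
  first I = one
  first (suc I) = two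
  second : ∀ d → Agree (O , d)
  second O = agree-⊕ (O , I) (O , # 2) one' two'
  second I = one'
  second (suc I) = two'
  ⊕-split : ∀ c d → (c , O) ⊕ (O , d) ≡ (c , d)
  ⊕-split = decide (all? λ c → all? λ d → ((c , O) ⊕ (O , d)) ≟² (c , d))

rowGroup : Echelon → Subset
rowGroup e x = ∃[ p ] ω-diag (comb (rows e) p) ≡ x

rowGroup-IsZ3² : ∀ e → IsZ3²SubOfG81 (rowGroup e)
rowGroup-IsZ3² e =
  (φ , φ-⊕ , (λ p q eq → comb-rows-injective e (ω-diag-injective eq)) , λ x → id , id) ,
  λ { x (p , eq) → subst InG81 eq (InG81-ω-diag (comb (rows e) p)) }
  where
  φ : Z3×Z3 → Mat
  φ p = ω-diag (comb (rows e) p)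
  φ-⊕ : ∀ p q → φ (p ⊕ q) ≡ φ p · φ q
  φ-⊕ p q = trans (cong ω-diag (comb-⊕ (rows e) p q))
    (trans (ω-diag-⊞ (comb (rows e) p) (comb (rows e) q)) (⊗-def (φ p) (φ q)))

rowGroup⇒InSpan : ∀ u e → rowGroup e (ω-diag u) → InSpan u (rows e)
rowGroup⇒InSpan u e (p , eq) = p , sym (ω-diag-injective eq)

rowGroup-injective : ∀ e e' → rowGroup e ≐ rowGroup e' → e ≡ e'
rowGroup-injective e e' same = rows-included⇒≡ e e'
  ( included (proj₁ (rows e)) ((I , O) , cong ω-diag (comb-10 (proj₁ (rows e)) (proj₂ (rows e))))
  , included (proj₂ (rows e)) ((O , I) , cong ω-diag (comb-01 (proj₁ (rows e)) (proj₂ (rows e)))) )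
  where
  included : ∀ u → rowGroup e (ω-diag u) → InSpan u (rows e')
  included u u∈ = rowGroup⇒InSpan u e' (proj₁ (same (ω-diag u)) u∈)

-- The embedding `φ` lifts through `ω-diag` to an additive, hence linear, map `τ` into F₃⁴, and `H`
-- corresponds to the span of the two vectors `U` and `V`.
rowGroup-complete : ∀ H → IsZ3²SubOfG81 H → ∃[ e ] H ≐ rowGroup e
rowGroup-complete H ((φ , φ-⊕ , φ-injective , image-φ) , H⊆G81) =
  by-cases (echelonForm (U , V)) (echelonForm-correct (U , V))
  where
  logarithm : ∀ p → ∃[ u ] ω-diag u ≡ φ p
  logarithm p = InG81⇒ω-diag (H⊆G81 (φ p) (proj₂ (image-φ (φ p)) (p , refl)))
  τ : Z3×Z3 → Code
  τ p = proj₁ (logarithm p)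
  ω-diag-τ : ∀ p → ω-diag (τ p) ≡ φ p
  ω-diag-τ p = proj₂ (logarithm p)
  U V : Code
  U = τ (I , O)
  V = τ (O , I)
  τ-⊕ : ∀ p q → τ (p ⊕ q) ≡ τ p ⊞ τ q
  τ-⊕ p q = ω-diag-injective (begin
    ω-diag (τ (p ⊕ q))             ≡⟨ ω-diag-τ (p ⊕ q) ⟩
    φ (p ⊕ q)                      ≡⟨ trans (φ-⊕ p q) (sym (⊗-def (φ p) (φ q))) ⟩
    φ p ⊗ φ q                      ≡⟨ cong₂ _⊗_ (ω-diag-τ p) (ω-diag-τ q) ⟨
    ω-diag (τ p) ⊗ ω-diag (τ q)    ≡⟨ ω-diag-⊞ (τ p) (τ q) ⟨
    ω-diag (τ p ⊞ τ q)             ∎)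
    where open ≡-Reasoning
  τ-comb : ∀ p → τ p ≡ comb (U , V) p
  τ-comb = additive⇒comb τ τ-⊕
  by-cases : ∀ m → HasEchelonForm (U , V) m → ∃[ e ] H ≐ rowGroup e
  -- A dependence between `U` and `V` would put a nonzero `p` in the kernel of `τ`, hence of the
  -- injective `φ`.
  by-cases nothing (p , p≢0 , comb≡0) = contradiction
    (φ-injective p (O , O) (trans (sym (ω-diag-τ p)) (trans (cong ω-diag τp≡τ0) (ω-diag-τ (O , O)))))
    p≢0
    where
    τp≡τ0 : τ p ≡ τ (O , O)
    τp≡τ0 = trans (trans (τ-comb p) comb≡0) (sym (trans (τ-comb (O , O)) (comb-00 U V)))
  by-cases (just e) (UV⊆e , e⊆UV) = e , λ x → into x , onto x
    where
    into : ∀ x → H x → rowGroup e x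
    into x x∈ =
      let (p , φp≡x) = proj₁ (image-φ x) x∈
          (q , τp≡) = InSpan-trans UV⊆e (p , τ-comb p)
      in q , trans (cong ω-diag (sym τp≡)) (trans (ω-diag-τ p) φp≡x)
    onto : ∀ x → rowGroup e x → H x
    onto x (p , eq) =
      let (q , comb≡) = InSpan-trans e⊆UV (p , refl)
      in proj₂ (image-φ x) (q , trans (sym (ω-diag-τ q))
           (trans (cong ω-diag (trans (τ-comb q) (sym comb≡))) eq))

-- Conjugate subgroups have the same class.

-- If V_h and V_k had the same image, the image of a basis vector of V_h would also come from a
-- vector of V_k. By injectivity of `g` the two vectors agree, and a nonzero vector lies in only one
-- block.
blockPermutation-injective : ∀ {g} → ((_ , maps) : InGL4 g) →
                             ∀ h k → proj₁ (maps h) ≡ proj₁ (maps k) → h ≡ k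
blockPermutation-injective {g} (inv , maps) h k πh≡πk =
  let (_ , into , _) = maps h
      (_ , _ , onto) = maps k
      (v , v∈k , gv≡ge) = onto (g ⊳ e) (subst ((g ⊳ e) ∈V_) πh≡πk (into e e∈h))
  in ∈V-disjoint {e} {h} {k} j (basis-self j) e∈h
       (subst (_∈V k) (⊳-injective {g} inv {v} {e} gv≡ge) v∈k)
  where
  j : Fin 8
  j = at h O
  e : V₈
  e = basis j
  e∈h : e ∈V h
  e∈h = subst (e ∈V_) (block-at h O) (basis-∈V j)

conjugate-weight : ∀ g → InGL4 g → ∀ u v → g · ω-diag u ≡ ω-diag v · g → weight u ≡ weight v
conjugate-weight g g∈@(inv , maps) u v eq =
  weight-permute π (blockPermutation-injective {g} g∈) u v λ h → mk⇔ (to h) (from h)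
  where
  open ≡-Reasoning
  π : Fin 4 → Fin 4
  π h = proj₁ (maps h)
  intertwine : ∀ x → g ⊳ (ω-diag u ⊳ x) ≡ ω-diag v ⊳ (g ⊳ x)
  intertwine x = begin
    g ⊳ (ω-diag u ⊳ x)     ≡⟨ ⊳-⊗ g (ω-diag u) x ⟨
    (g ⊗ ω-diag u) ⊳ x     ≡⟨ cong (_⊳ x) (⊗-commuting g (ω-diag u) (ω-diag v) eq) ⟩
    (ω-diag v ⊗ g) ⊳ x     ≡⟨ ⊳-⊗ (ω-diag v) g x ⟩
    ω-diag v ⊳ (g ⊳ x)     ∎
  to : ∀ h → lookup u h ≡ zero → lookup v (π h) ≡ zero
  to h uh≡0 = ω-diag-fixes⁻¹ v (π h) λ w w∈ →
    let (x , x∈h , gx≡w) = proj₂ (proj₂ (maps h)) w w∈ in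
    begin
      ω-diag v ⊳ w           ≡⟨ cong (ω-diag v ⊳_) gx≡w ⟨
      ω-diag v ⊳ (g ⊳ x)     ≡⟨ intertwine x ⟨
      g ⊳ (ω-diag u ⊳ x)     ≡⟨ cong (g ⊳_) (ω-diag-fixes u h uh≡0 x x∈h) ⟩
      g ⊳ x                  ≡⟨ gx≡w ⟩
      w                      ∎
  from : ∀ h → lookup v (π h) ≡ zero → lookup u h ≡ zero
  from h vπh≡0 = ω-diag-fixes⁻¹ u h λ x x∈h →
    ⊳-injective {g} inv {ω-diag u ⊳ x} {x} (trans (intertwine x)
      (ω-diag-fixes v (π h) vπh≡0 (g ⊳ x) (proj₁ (proj₂ (maps h)) x x∈h)))

conjugate⇒class≡ : ∀ e e' → ConjugateInGL4 (rowGroup e) (rowGroup e') → class e ≡ class e'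
conjugate⇒class≡ e e' (g , g∈ , to , from) = class-cong e e' λ w → mk⇔
  (λ (p , weight≡w) →
    let (y , (q , eq) , gx≡yg) = to (ω-diag (comb (rows e) p)) (p , refl) in
    q , trans (sym (conjugate-weight g g∈ (comb (rows e) p) (comb (rows e') q)
                 (trans gx≡yg (cong (_· g) (sym eq))))) weight≡w)
  (λ (q , weight≡w) →
    let (x , (p , eq) , gx≡yg) = from (ω-diag (comb (rows e') q)) (q , refl) in
    p , trans (conjugate-weight g g∈ (comb (rows e) p) (comb (rows e') q)
                 (trans (cong (g ·_) eq) gx≡yg)) weight≡w)

-- Subgroups of the same class are conjugate.

ConjugateInGL4-refl : ∀ H → ConjugateInGL4 H H
ConjugateInGL4-refl H =
  I₈ , subst InGL4 ω-diag-zero (InGL4-ω-diag 0̂) ,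
  (λ x x∈ → x , x∈ , commutes x) , (λ x x∈ → x , x∈ , commutes x)
  where
  commutes : ∀ x → I₈ · x ≡ x · I₈
  commutes x = ·-commuting I₈ x x (trans (⊗-identityˡ x) (sym (⊗-identityʳ x)))

MapsSpan⇒conjugate : ∀ s e e' → MapsSpan s e e' → ConjugateInGL4 (rowGroup e) (rowGroup e')
MapsSpan⇒conjugate s e e' (to , from) =
  generatorMat s , InGL4-generatorMat s ,
  (λ { x (p , refl) → let (q , eq) = to p in
       ω-diag (comb (rows e') q) , (q , refl) , commutes p q eq }) ,
  (λ { y (q , refl) → let (p , eq) = from q in
       ω-diag (comb (rows e) p) , (p , refl) , commutes p q eq })
  where
  commutes : ∀ p q → act s (comb (rows e) p) ≡ comb (rows e') q →
    generatorMat s · ω-diag (comb (rows e) p) ≡ ω-diag (comb (rows e') q) · generatorMat s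
  commutes p q eq = ·-commuting (generatorMat s) (ω-diag (comb (rows e) p)) (ω-diag (comb (rows e') q))
    (trans (generatorMat-conjugates s (comb (rows e) p))
           (cong (λ u → ω-diag u ⊗ generatorMat s) eq))

-- Both directions are carried along. Each generator is an involution, so every step of the descent
-- reverses by itself and no general element of 𝒢(ℒ₄) has to be inverted.
_∼_ : Echelon → Echelon → Set
e ∼ e' = ConjugateInGL4 (rowGroup e) (rowGroup e') × ConjugateInGL4 (rowGroup e') (rowGroup e)

∼-representative : ∀ e → Acc _<_ (rank e) → e ∼ representative (class e)
∼-representative e (acc smaller) = by-cases (descent e)
  where
  by-cases : e ≡ representative (class e) ⊎ Descends e → e ∼ representative (class e)
  by-cases (inj₁ e≡) = subst (e ∼_) e≡
    (ConjugateInGL4-refl (rowGroup e) , ConjugateInGL4-refl (rowGroup e))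
  by-cases (inj₂ descends) =
    ConjugateInGL4-trans {rowGroup e} {rowGroup e'} {rowGroup r} down (proj₁ rest) ,
    ConjugateInGL4-trans {rowGroup r} {rowGroup e'} {rowGroup e} (proj₂ rest) up
    where
    found : Decreases e
    found = Descends⇒Decreases {e} descends
    s : Generator
    s = proj₁ found
    e' r : Echelon
    e' = proj₁ (proj₂ found)
    r = representative (class e)
    maps : MapsSpan s e e'
    maps = proj₂ (proj₂ (proj₂ found))
    down : ConjugateInGL4 (rowGroup e) (rowGroup e')
    down = MapsSpan⇒conjugate s e e' maps
    up : ConjugateInGL4 (rowGroup e') (rowGroup e)
    up = MapsSpan⇒conjugate s e' e (MapsSpan-sym s e e' maps)
    rest : e' ∼ r
    -- Since `e` and `e'` are conjugate they have the same class, so the descent from `e'` ends at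
    -- the representative belonging to `e`.
    rest = subst (λ c → e' ∼ representative c) (sym (conjugate⇒class≡ e e' down))
      (∼-representative e' (smaller (proj₁ (proj₂ (proj₂ found)))))

class≡⇒conjugate : ∀ e e' → class e ≡ class e' → ConjugateInGL4 (rowGroup e) (rowGroup e')
class≡⇒conjugate e e' same =
  ConjugateInGL4-trans {rowGroup e} {rowGroup (representative (class e'))} {rowGroup e'}
    (proj₁ (subst (λ c → e ∼ representative c) same (∼-representative e (<-wellFounded (rank e)))))
    (proj₂ (∼-representative e' (<-wellFounded (rank e'))))

theorem5 : Σ (Fin 130 → Subset) λ K →
    (∀ i → IsZ3²SubOfG81 (K i)) ×
    (∀ i j → K i ≐ K j → i ≡ j) ×
    (∀ H → IsZ3²SubOfG81 H → Σ (Fin 130) λ i → H ≐ K i) ×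
    Σ (Fin 130 → Fin 7) λ cls →
    (∀ i j → ConjugateInGL4 (K i) (K j) ⇔ (cls i ≡ cls j)) ×
    (∀ c → fiberSize cls c ≡ lookup (6 ∷ 24 ∷ 16 ∷ 12 ∷ 16 ∷ 48 ∷ 8 ∷ []) c)
theorem5 =
  (λ i → rowGroup (echelonAt i)) ,
  (λ i → rowGroup-IsZ3² (echelonAt i)) ,
  (λ i j same → trans (sym (position-echelonAt i))
    (trans (cong position (rowGroup-injective (echelonAt i) (echelonAt j) same))
           (position-echelonAt j))) ,
  (λ H H∈ → let (e , same) = rowGroup-complete H H∈ in
    position e , subst (λ e → H ≐ rowGroup e) (sym (echelonAt-position e)) same) ,
  (λ i → class (echelonAt i)) ,
  (λ i j → mk⇔ (conjugate⇒class≡ (echelonAt i) (echelonAt j))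
               (class≡⇒conjugate (echelonAt i) (echelonAt j))) ,
  class-size
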